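{- Let $q\geq 3$ and let $m$ be a positive integer divisible by $q$. Then there exist a code $C$ in the Hamming graph $\Gamma=H(m,q)$ with minimum distance $\delta=3$ and a group $X\leq \mathrm{Aut}(\Gamma)$ such that $(C,X)$ is an elusive pair with parameters $(m,q,3)$ and $X$ acts transitively on $\Gamma_1(C)$.
   Context: Hamming graph: for a finite set $Q$ of size $q$, $\Gamma=H(m,q)$ is the graph whose vertices are all $m$-tuples with entries in $Q$, two $m$-tuples being adjacent if and only if they differ in exactly one position. $\mathrm{Aut}(\Gamma)$ is its automorphism group. The distance $d(\alpha,\beta)$ between vertices is the number of entries in which they differ. A code is a subset $C$ of the vertex set of $\Gamma$; its minimum distance is $\delta=\min\{d(\alpha,\beta)\mid \alpha,\beta\in C,\ \alpha\neq\beta\}$. The set of neighbours of $C$, denoted $\Gamma_1(C)$, is the set of all vertices of $\Gamma$ that are not in $C$ but are adjacent to at least one element of $C$. Elusive pair: let $C$ be a code in $\Gamma=H(m,q)$ with minimum distance $\delta$ and let $X\leq\mathrm{Aut}(\Gamma)$ be such that $X$ fixes $\Gamma_1(C)$ setwise but does not fix $C$ setwise. Then $(C,X)$ is called an elusive pair with parameters $(m,q,\delta)$. -}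

module Defs where

open import Algebra.Bundles using (Group)
open import Data.Fin.Base using (Fin)
open import Data.Fin.Properties using (_≟_)
open import Data.Nat.Base using (ℕ; _≤_)
open import Data.Product.Base using (∃; ∃₂; _×_; _,_; uncurry)
open import Data.Product using (∃!)
open import Data.Vec.Base using (Vec; lookup; zip; count)
open import Function.Bundles using (_↔_; _⇔_; Inverse; Equivalence; mk⇔)
open import Function.Construct.Composition using (_⇔-∘_; _↔-∘_)
open import Function.Construct.Identity using (↔-id; ⇔-id)
open import Function.Construct.Symmetry using (↔-sym; ⇔-sym)
open import Level using (Level; 0ℓ; _⊔_) renaming (suc to lsuc)
open import Relation.Binary.PropositionalEquality
  using (_≡_; _≢_; refl; sym; trans; cong; subst₂)
open import Relation.Nullary using (¬_)
open import Relation.Nullary.Decidable using (¬?)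
open import Relation.Unary using (Pred; _∈_; _∉_; _≐_)

record Subgroup {c ℓ} (G : Group c ℓ) (p : Level) : Set (c ⊔ ℓ ⊔ lsuc p) where
  open Group G
  field
    Member    : Pred Carrier p
    resp-≈    : ∀ {g h} → g ≈ h → Member g → Member h
    ε-closed  : Member ε
    ∙-closed  : ∀ {g h} → Member g → Member h → Member (g ∙ h)
    ⁻¹-closed : ∀ {g} → Member g → Member (g ⁻¹)

-- The alphabet Q of H(m,q) is taken to be Fin q.
Vertex : ℕ → ℕ → Set
Vertex m q = Vec (Fin q) m

module _ {m q : ℕ} where

  Adjacent : Vertex m q → Vertex m q → Set
  Adjacent α β = ∃! _≡_ λ i → lookup α i ≢ lookup β i

  d : Vertex m q → Vertex m q → ℕ
  d α β = count (uncurry λ x y → ¬? (x ≟ y)) (zip α β)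

record Automorphism (m q : ℕ) : Set where
  field
    bijection : Vertex m q ↔ Vertex m q

  open Inverse bijection public using (to; from; strictlyInverseˡ; strictlyInverseʳ)

  field
    adjacency : ∀ α β → Adjacent α β ⇔ Adjacent (to α) (to β)

open Automorphism using (to; from; adjacency)

-- Aut(H(m,q)) under composition; automorphisms are compared pointwise, since
-- function extensionality is not available.
Aut : ℕ → ℕ → Group 0ℓ 0ℓ
Aut m q = record
  { Carrier = Automorphism m q
  ; _≈_     = λ g h → ∀ α → to g α ≡ to h α
  ; _∙_     = _∘ᵃ_
  ; ε       = record { bijection = ↔-id _ ; adjacency = λ _ _ → ⇔-id _ }
  ; _⁻¹     = inverse
  ; isGroup = record
    { isMonoid = record
      { isSemigroup = record
        { isMagma = record
          { isEquivalence = record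
            { refl  = λ _ → refl
            ; sym   = λ p α → sym (p α)
            ; trans = λ p r α → trans (p α) (r α)
            }
          ; ∙-cong = λ {g} {h} {k} {l} p r α →
              trans (cong (to g) (r α)) (p (to l α))
          }
        ; assoc = λ _ _ _ _ → refl
        }
      ; identity = (λ _ _ → refl) , (λ _ _ → refl)
      }
    ; inverse = (λ g → Automorphism.strictlyInverseʳ g)
              , (λ g → Automorphism.strictlyInverseˡ g)
    ; ⁻¹-cong = λ {g} {h} p α →
        trans (cong (from g) (trans (sym (Automorphism.strictlyInverseˡ h α))
                                    (sym (p (from h α)))))
              (Automorphism.strictlyInverseʳ g (from h α))
    }
  }
  where
  _∘ᵃ_ : Automorphism m q → Automorphism m q → Automorphism m q
  g ∘ᵃ h = record
    { bijection = Automorphism.bijection g ↔-∘ Automorphism.bijection h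
    ; adjacency = λ α β → adjacency g (to h α) (to h β) ⇔-∘ adjacency h α β
    }

  inverse : Automorphism m q → Automorphism m q
  inverse g = record
    { bijection = ↔-sym (Automorphism.bijection g)
    ; adjacency = λ α β → mk⇔
        (λ a → Equivalence.from (adjacency g (from g α) (from g β))
          (subst₂ Adjacent (sym (Automorphism.strictlyInverseˡ g α))
                           (sym (Automorphism.strictlyInverseˡ g β)) a))
        (λ a → subst₂ Adjacent (Automorphism.strictlyInverseˡ g α)
                               (Automorphism.strictlyInverseˡ g β)
          (Equivalence.to (adjacency g (from g α) (from g β)) a))
    }

Code : ℕ → ℕ → Set₁
Code m q = Pred (Vertex m q) 0ℓ

module _ {m q : ℕ} where

  record MinimumDistance (C : Code m q) (δ : ℕ) : Set where
    field
      attained   : ∃₂ λ α β → α ∈ C × β ∈ C × α ≢ β × d α β ≡ δ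
      lowerBound : ∀ {α β} → α ∈ C → β ∈ C → α ≢ β → δ ≤ d α β

  Γ₁ : Code m q → Pred (Vertex m q) 0ℓ
  Γ₁ C ν = ν ∉ C × ∃ λ α → α ∈ C × Adjacent ν α

  image : Automorphism m q → Pred (Vertex m q) 0ℓ → Pred (Vertex m q) 0ℓ
  image g Δ β = ∃ λ α → α ∈ Δ × to g α ≡ β

  FixesSetwise : Subgroup (Aut m q) 0ℓ → Pred (Vertex m q) 0ℓ → Set
  FixesSetwise X Δ = ∀ g → g ∈ Subgroup.Member X → image g Δ ≐ Δ

  -- Meaningful only when X fixes Δ setwise; this is not required here.
  TransitiveOn : Subgroup (Aut m q) 0ℓ → Pred (Vertex m q) 0ℓ → Set
  TransitiveOn X Δ = ∀ {α β} → α ∈ Δ → β ∈ Δ →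
    ∃ λ g → g ∈ Subgroup.Member X × to g α ≡ β

record ElusivePair (m q δ : ℕ) (C : Code m q) (X : Subgroup (Aut m q) 0ℓ) : Set where
  field
    minimumDistance : MinimumDistance C δ
    fixesNeighbours : FixesSetwise X (Γ₁ C)
    movesCode       : ¬ FixesSetwise X C

{-# OPTIONS --safe #-}
module Submission where

open import Defs
open import Data.Bool.Base using (Bool; true; false; not; _xor_)
open import Data.Bool.Properties using (not-involutive; not-¬; ¬-not) renaming (_≟_ to _≟ᵇ_)
open import Data.Bool.Solver using (module xor-∧-Solver)
open import Data.Fin.Base using (Fin; zero; suc; combine; quotient; remainder; punchOut)
open import Data.Fin.Base using () renaming (_<_ to _<ᶠ_; _≤_ to _≤ᶠ_)
open import Data.Fin.Permutation using (Permutation′; permutation; transpose; _∘ₚ_; _⟨$⟩ʳ_; _⟨$⟩ˡ_; inverseˡ; inverseʳ; flip) renaming (id to idₚ)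
import Data.Fin.Permutation.Components as PC
open import Data.Fin.Properties using (_≟_; _<?_; any?; <-cmp; <-irrefl; ≤-antisym; combine-monoˡ-<; combine-remQuot; remQuot-combine; combine-injectiveʳ; punchOut-injective; injective⇒≤; ¬∀⟶∃¬; *↔×; <⇒≢)
open import Data.Nat.Base using (ℕ; _≤_; _<_; _*_; zero; suc; s≤s; z≤n; s<s; s<s⁻¹; z<s)
open import Data.Nat.Divisibility using (_∣_; divides)
import Data.Nat.Properties as ℕ
open import Data.Product.Base using (Σ; _×_; _,_; proj₁; proj₂; ∃; ∃₂)
open import Data.Product.Function.NonDependent.Propositional using (_×-↔_)
open import Data.Vec.Base using (Vec; []; _∷_; head; lookup; tabulate; zip; count; removeAt; _[_]≔_)
open import Data.Vec.Properties using (lookup∘tabulate; tabulate∘lookup; tabulate-cong; lookup∘update; lookup∘update′; lookup-zip; removeAt-punchOut)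
open import Function.Base using (_∘_)
open import Function.Bundles using (_⇔_; Equivalence; mk⇔; mk↔ₛ′)
open import Function.Construct.Composition using (_⇔-∘_; _↔-∘_)
open import Function.Construct.Identity using (⇔-id)
open import Function.Construct.Symmetry using (⇔-sym; ↔-sym)
open import Function.Definitions using (Injective)
open import Level using (0ℓ; Level)
open import Relation.Binary.Definitions using (Tri; tri<; tri≈; tri>)
open import Relation.Binary.PropositionalEquality
open import Relation.Nullary using (¬_; does; yes; no; contradiction)
open import Relation.Nullary.Decidable using (decidable-stable; dec-true; dec-false; ¬?; _×-dec_)
open import Relation.Unary using (Pred; Decidable; _∈_)

-- Cut the m coordinates into blocks of length q. The code consists of the words whose
-- restriction to each block is a permutation of the alphabet, with prescribed parity of the
-- total number of inversions. Two such words of equal parity cannot differ in exactly two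
-- places, since they would then differ by a transposition inside one block. A neighbour of the
-- code has one block with a repeated letter, and it is adjacent to exactly two blockwise
-- permutations, one of each parity. Hence the neighbour set is the same for both parities, and
-- it is preserved by all automorphisms preserving the blockwise permutations, some of which
-- exchange the parities.

open Automorphism using (to; from; adjacency; strictlyInverseˡ)

private
  variable
    a ℓ : Level
    A : Set a
    m n p q : ℕ

-- Words and permutations of finite sets

lookup-ext : {xs ys : Vec A n} → (∀ i → lookup xs i ≡ lookup ys i) → xs ≡ ys
lookup-ext {xs = xs} {ys} eq =
  trans (sym (tabulate∘lookup xs)) (trans (tabulate-cong eq) (tabulate∘lookup ys))

-- Pigeonhole: if `y` were missed, punching it out of the codomain would leave an injection into a
-- smaller set.
injective⇒surjective : {f : Fin n → Fin n} → Injective _≡_ _≡_ f → ∀ y → ∃ λ x → f x ≡ y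
injective⇒surjective {suc n} {f} inj y with any? (λ x → f x ≟ y)
... | yes hit = hit
... | no  miss = contradiction (injective⇒≤ {f = λ x → punchOut (y≢f x)} punched) ℕ.1+n≰n
  where
  y≢f : ∀ x → y ≢ f x
  y≢f x y≡fx = miss (x , sym y≡fx)
  punched : Injective _≡_ _≡_ (λ x → punchOut (y≢f x))
  punched {x} {x′} eq = inj (punchOut-injective (y≢f x) (y≢f x′) eq)

-- The forward map is `f` itself, so that applying a `blockPermutation` later unfolds to a `lookup`
-- by definition.
injective⇒permutation : (f : Fin n → Fin n) → Injective _≡_ _≡_ f → Permutation′ n
injective⇒permutation f inj = permutation f (proj₁ ∘ surj) (proj₂ ∘ surj)
  (λ x → inj (proj₂ (surj (f x))))
  where surj = injective⇒surjective inj

transpose-ˡ : (i j : Fin n) → PC.transpose i j i ≡ j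
transpose-ˡ i j rewrite dec-true (i ≟ i) refl = refl

transpose-other : {i j k : Fin n} → k ≢ i → k ≢ j → PC.transpose i j k ≡ k
transpose-other {i = i} {j} {k} k≢i k≢j
  rewrite dec-false (k ≟ i) k≢i | dec-false (k ≟ j) k≢j = refl

-- Two transpositions suffice: the first takes `x` to `x′`, the second takes the image of `y` to
-- `y′` and fixes `x′`, which differs from both.
permutation-through-pairs : {x y x′ y′ : Fin n} → x ≢ y → x′ ≢ y′ →
  ∃ λ (ρ : Permutation′ n) → ρ ⟨$⟩ʳ x ≡ x′ × ρ ⟨$⟩ʳ y ≡ y′
permutation-through-pairs {x = x} {y} {x′} {y′} x≢y x′≢y′ =
  τ ∘ₚ transpose (τ ⟨$⟩ʳ y) y′ ,
  trans (cong (PC.transpose (τ ⟨$⟩ʳ y) y′) (transpose-ˡ x x′)) (transpose-other x′≢τy x′≢y′) ,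
  transpose-ˡ (τ ⟨$⟩ʳ y) y′
  where
  τ = transpose x x′
  x′≢τy : x′ ≢ τ ⟨$⟩ʳ y
  x′≢τy eq = x≢y (begin
    x                    ≡⟨ inverseˡ τ ⟨
    τ ⟨$⟩ˡ (τ ⟨$⟩ʳ x)    ≡⟨ cong (τ ⟨$⟩ˡ_) (trans (transpose-ˡ x x′) eq) ⟩
    τ ⟨$⟩ˡ (τ ⟨$⟩ʳ y)    ≡⟨ inverseˡ τ ⟩
    y                    ∎)
    where open ≡-Reasoning

-- Lower bounds for counts and distances

module _ {P : Pred A ℓ} (P? : Decidable P) where

  count-removeAt : (xs : Vec A (suc n)) (i : Fin (suc n)) → P (lookup xs i) →
    count P? xs ≡ suc (count P? (removeAt xs i))
  count-removeAt (x ∷ xs) zero Px rewrite dec-true (P? x) Px = refl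
  count-removeAt (x ∷ xs@(_ ∷ _)) (suc i) Pxᵢ with does (P? x)
  ... | true  = cong suc (count-removeAt xs i Pxᵢ)
  ... | false = count-removeAt xs i Pxᵢ

  count-suc : (xs : Vec A (suc n)) {i : Fin (suc n)} → P (lookup xs i) →
    ∀ {k} → k ≤ count P? (removeAt xs i) → suc k ≤ count P? xs
  count-suc xs {i} Pxᵢ k≤ rewrite count-removeAt xs i Pxᵢ = s≤s k≤

  -- The three positions are removed one after the other, each lowering the count by one; `punchOut`
  -- tracks where the remaining ones end up.
  3≤count : (xs : Vec A n) {i j k : Fin n} → i ≢ j → i ≢ k → j ≢ k →
    P (lookup xs i) → P (lookup xs j) → P (lookup xs k) → 3 ≤ count P? xs
  3≤count {suc zero} xs {zero} {zero} i≢j _ _ _ _ _ = contradiction refl i≢j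
  -- After removing `i` from a word of length two, a single place is left for both `j` and `k`.
  3≤count {suc (suc zero)} xs {i} {j} {k} i≢j i≢k j≢k _ _ _
    with punchOut i≢j in eq | punchOut i≢k in eq′
  ... | zero | zero = contradiction (punchOut-injective i≢j i≢k (trans eq (sym eq′))) j≢k
  3≤count {suc (suc (suc n))} xs {i} {j} {k} i≢j i≢k j≢k Pxᵢ Pxⱼ Pxₖ =
    count-suc xs Pxᵢ
      (count-suc xs′ (subst P (sym (removeAt-punchOut xs i≢j)) Pxⱼ)
        (count-suc (removeAt xs′ (punchOut i≢j))
          (subst P (sym (trans (removeAt-punchOut xs′ j′≢k′) (removeAt-punchOut xs i≢k))) Pxₖ)
          z≤n))
    where
    xs′ = removeAt xs i
    j′≢k′ : punchOut i≢j ≢ punchOut i≢k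
    j′≢k′ = j≢k ∘ punchOut-injective i≢j i≢k

3≤d : (α β : Vertex m q) {i j k : Fin m} → i ≢ j → i ≢ k → j ≢ k →
  lookup α i ≢ lookup β i → lookup α j ≢ lookup β j → lookup α k ≢ lookup β k → 3 ≤ d α β
3≤d α β {i} {j} {k} i≢j i≢k j≢k αᵢ≢ αⱼ≢ αₖ≢ =
  3≤count _ (zip α β) i≢j i≢k j≢k (at i αᵢ≢) (at j αⱼ≢) (at k αₖ≢)
  where
  at : ∀ l → lookup α l ≢ lookup β l →
    proj₁ (lookup (zip α β) l) ≢ proj₂ (lookup (zip α β) l)
  at l rewrite lookup-zip l α β = λ neq → neq

-- Inversions modulo 2

infix 7 _≺_

-- Boolean values make parity arguments into `xor` identities for the ring solver.
_≺_ : Fin q → Fin q → Bool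
x ≺ y = does (x <? y)

≺-irrefl : (x : Fin q) → x ≺ x ≡ false
≺-irrefl x = dec-false (x <? x) (<-irrefl refl)

≺-connected : {x y : Fin q} → x ≢ y → x ≺ y ≡ true xor y ≺ x
≺-connected {x = x} {y} x≢y with <-cmp x y
... | tri< x<y _ y≮x rewrite dec-true (x <? y) x<y | dec-false (y <? x) y≮x = refl
... | tri≈ _ x≡y _ = contradiction x≡y x≢y
... | tri> x≮y _ y<x rewrite dec-false (x <? y) x≮y | dec-true (y <? x) y<x = refl

-- Modulo 2, the number of inversions that an entry `x` forms with a word standing after it.
parityBelow : Fin q → Vertex n q → Bool
parityBelow x []       = false
parityBelow x (y ∷ ys) = y ≺ x xor parityBelow x ys

-- The inversion number modulo 2 of the whole word; inversions between different blocks count as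
-- well.
parity : Vertex n q → Bool
parity []       = false
parity (x ∷ xs) = parityBelow x xs xor parity xs

parityBelow-update : (z : Fin q) (xs : Vertex n q) (j : Fin n) (x : Fin q) →
  parityBelow z (xs [ j ]≔ x) ≡ lookup xs j ≺ z xor x ≺ z xor parityBelow z xs
parityBelow-update z (y ∷ xs) zero x =
  solve 3 (λ a b c → b :+ c := a :+ (b :+ (a :+ c))) refl (y ≺ z) (x ≺ z) (parityBelow z xs)
  where open xor-∧-Solver
parityBelow-update z (w ∷ xs) (suc j) x =
  trans (cong (w ≺ z xor_) (parityBelow-update z xs j x))
    (solve 4 (λ a b c d → a :+ (b :+ (c :+ d)) := b :+ (c :+ (a :+ d))) refl
      (w ≺ z) (lookup xs j ≺ z) (x ≺ z) (parityBelow z xs))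
  where open xor-∧-Solver

-- `parityBelow` runs over the whole word here, although entries before `j` are compared in the
-- other direction: turning the comparison round costs a bit for the old letter and a bit for `x`,
-- and these cancel. The leading term removes the comparison of `x` with the old entry at `j`, which
-- `parityBelow x xs` includes.
parity-update : (xs : Vertex n q) (j : Fin n) (x : Fin q) →
  (∀ k → k <ᶠ j → lookup xs k ≢ x × lookup xs k ≢ lookup xs j) →
  parity (xs [ j ]≔ x) ≡
    lookup xs j ≺ x xor parityBelow x xs xor parityBelow (lookup xs j) xs xor parity xs
parity-update (y ∷ xs) zero x _ rewrite ≺-irrefl y =
  solve 4 (λ a b c d → b :+ d := a :+ ((a :+ b) :+ (c :+ (c :+ d)))) refl
    (y ≺ x) (parityBelow x xs) (parityBelow y xs) (parity xs)
  where open xor-∧-Solver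
parity-update (z ∷ xs) (suc j) x distinct = begin
  parityBelow z (xs [ j ]≔ x) xor parity (xs [ j ]≔ x)
    ≡⟨ cong₂ _xor_ (parityBelow-update z xs j x)
         (parity-update xs j x (λ k k<j → distinct (suc k) (s<s k<j))) ⟩
  (y ≺ z xor x ≺ z xor parityBelow z xs) xor (y ≺ x xor parityBelow x xs xor parityBelow y xs xor parity xs)
    ≡⟨ cong₂ (λ a b → (a xor b xor parityBelow z xs) xor (y ≺ x xor parityBelow x xs xor parityBelow y xs xor parity xs))
         (≺-connected (proj₂ z-distinct ∘ sym)) (≺-connected (proj₁ z-distinct ∘ sym)) ⟩
  ((true xor z ≺ y) xor (true xor z ≺ x) xor parityBelow z xs) xor (y ≺ x xor parityBelow x xs xor parityBelow y xs xor parity xs)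
    ≡⟨ solve 7 (λ zy zx pz yx px py ps →
         ((con true :+ zy) :+ ((con true :+ zx) :+ pz)) :+ (yx :+ (px :+ (py :+ ps)))
         := yx :+ ((zx :+ px) :+ ((zy :+ py) :+ (pz :+ ps)))) refl
         (z ≺ y) (z ≺ x) (parityBelow z xs) (y ≺ x) (parityBelow x xs) (parityBelow y xs) (parity xs) ⟩
  y ≺ x xor (z ≺ x xor parityBelow x xs) xor (z ≺ y xor parityBelow y xs) xor (parityBelow z xs xor parity xs) ∎
  where
  open ≡-Reasoning
  open xor-∧-Solver
  y = lookup xs j
  z-distinct = distinct zero z<s

-- Swapping two entries

-- Two updates, so that the update formulas for parity apply.
swap : Fin n → Fin n → Vec A n → Vec A n
swap i j xs = (xs [ i ]≔ lookup xs j) [ j ]≔ lookup xs i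

lookup-swap : (i j : Fin n) (xs : Vec A n) (k : Fin n) →
  lookup (swap i j xs) k ≡ lookup xs (PC.transpose i j k)
lookup-swap i j xs k with k ≟ i
lookup-swap i j xs k | yes refl with k ≟ j
... | yes refl = lookup∘update k (xs [ k ]≔ _) _
... | no k≢j   = trans (lookup∘update′ k≢j (xs [ k ]≔ _) _) (lookup∘update k xs _)
lookup-swap i j xs k | no k≢i with k ≟ j
... | yes refl = lookup∘update k (xs [ i ]≔ _) _
... | no k≢j   = trans (lookup∘update′ k≢j (xs [ i ]≔ _) _) (lookup∘update′ k≢i xs _)

lookup-swapˡ : (i j : Fin n) (xs : Vec A n) → lookup (swap i j xs) i ≡ lookup xs j
lookup-swapˡ i j xs = trans (lookup-swap i j xs i) (cong (lookup xs) (transpose-ˡ i j))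

lookup-swapʳ : (i j : Fin n) (xs : Vec A n) → lookup (swap i j xs) j ≡ lookup xs i
lookup-swapʳ i j xs = lookup∘update j (xs [ i ]≔ lookup xs j) (lookup xs i)

lookup-swap-other : {i j k : Fin n} (xs : Vec A n) → k ≢ i → k ≢ j →
  lookup (swap i j xs) k ≡ lookup xs k
lookup-swap-other {i = i} {j} {k} xs k≢i k≢j =
  trans (lookup-swap i j xs k) (cong (lookup xs) (transpose-other k≢i k≢j))

-- Allows `parity-swap-block` to assume that the first position is the smaller one.
swap-comm : (i j : Fin n) (xs : Vec A n) → swap i j xs ≡ swap j i xs
swap-comm i j xs = lookup-ext pointwise
  where
  pointwise : ∀ k → lookup (swap i j xs) k ≡ lookup (swap j i xs) k
  pointwise k with k ≟ i | k ≟ j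
  ... | yes refl | _        = trans (lookup-swapˡ k j xs) (sym (lookup-swapʳ j k xs))
  ... | no _     | yes refl = trans (lookup-swapʳ i k xs) (sym (lookup-swapˡ k i xs))
  ... | no k≢i   | no k≢j   =
    trans (lookup-swap-other xs k≢i k≢j) (sym (lookup-swap-other xs k≢j k≢i))

-- Each of the two letters is removed once and inserted once, so the four comparisons with `z`
-- cancel in pairs.
parityBelow-swap : (z : Fin q) (xs : Vertex n q) {i j : Fin n} → i ≢ j →
  parityBelow z (swap i j xs) ≡ parityBelow z xs
parityBelow-swap z xs {i} {j} i≢j
  rewrite parityBelow-update z (xs [ i ]≔ lookup xs j) j (lookup xs i)
        | parityBelow-update z xs i (lookup xs j)
        | lookup∘update′ (i≢j ∘ sym) xs (lookup xs j) =
  solve 3 (λ a b c → b :+ (a :+ (a :+ (b :+ c))) := c) refl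
    (lookup xs i ≺ z) (lookup xs j ≺ z) (parityBelow z xs)
  where open xor-∧-Solver

-- Entries outside the interval from i to j do not matter, so this applies to words with
-- repeated letters as long as the repetitions occur in different blocks.
parity-swap : (xs : Vertex n q) {i j : Fin n} → i <ᶠ j → lookup xs i ≢ lookup xs j →
  (∀ k → i <ᶠ k → k <ᶠ j → lookup xs k ≢ lookup xs i × lookup xs k ≢ lookup xs j) →
  parity (swap i j xs) ≡ not (parity xs)
parity-swap (x ∷ xs) {zero} {suc j} _ x≢y distinct = begin
  parityBelow y (xs [ j ]≔ x) xor parity (xs [ j ]≔ x)
    ≡⟨ cong₂ _xor_ (parityBelow-update y xs j x)
         (parity-update xs j x (λ k k<j → distinct (suc k) z<s (s<s k<j))) ⟩
  (y ≺ y xor x ≺ y xor parityBelow y xs) xor (y ≺ x xor parityBelow x xs xor parityBelow y xs xor parity xs)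
    ≡⟨ cong₂ (λ a b → (a xor b xor parityBelow y xs) xor (y ≺ x xor parityBelow x xs xor parityBelow y xs xor parity xs))
         (≺-irrefl y) (≺-connected x≢y) ⟩
  (false xor (true xor y ≺ x) xor parityBelow y xs) xor (y ≺ x xor parityBelow x xs xor parityBelow y xs xor parity xs)
    ≡⟨ solve 4 (λ py yx px ps →
         ((con true :+ yx) :+ py) :+ (yx :+ (px :+ (py :+ ps))) := con true :+ (px :+ ps)) refl
         (parityBelow y xs) (y ≺ x) (parityBelow x xs) (parity xs) ⟩
  true xor (parityBelow x xs xor parity xs) ∎
  where
  open ≡-Reasoning
  open xor-∧-Solver
  y = lookup xs j
parity-swap (x ∷ xs) {suc i} {suc j} i<j xᵢ≢xⱼ distinct = begin
  parityBelow x (swap i j xs) xor parity (swap i j xs)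
    ≡⟨ cong₂ _xor_ (parityBelow-swap x xs (<⇒≢ (s<s⁻¹ i<j)))
         (parity-swap xs (s<s⁻¹ i<j) xᵢ≢xⱼ
           (λ k i<k k<j → distinct (suc k) (s<s i<k) (s<s k<j))) ⟩
  parityBelow x xs xor not (parity xs)
    ≡⟨ solve 2 (λ a b → a :+ (con true :+ b) := con true :+ (a :+ b)) refl
         (parityBelow x xs) (parity xs) ⟩
  not (parityBelow x xs xor parity xs) ∎
  where
  open ≡-Reasoning
  open xor-∧-Solver

-- Automorphisms from permutations of coordinates and letters

module _ {m q : ℕ} (σ : Fin m → Permutation′ q) (π : Permutation′ m) where

  -- An element of the wreath product of Sym(q) by Sym(m): entries move along `π`, then `σ`, indexed
  -- by the target position, acts on the letters.
  permuteVertex : Vertex m q → Vertex m q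
  permuteVertex α = tabulate λ y → σ y ⟨$⟩ʳ lookup α (π ⟨$⟩ˡ y)

  permuteVertex⁻¹ : Vertex m q → Vertex m q
  permuteVertex⁻¹ β = tabulate λ x → σ (π ⟨$⟩ʳ x) ⟨$⟩ˡ lookup β (π ⟨$⟩ʳ x)

  lookup-permuteVertex : ∀ α y → lookup (permuteVertex α) y ≡ σ y ⟨$⟩ʳ lookup α (π ⟨$⟩ˡ y)
  lookup-permuteVertex α y = lookup∘tabulate _ y

  lookup-permuteVertex⁻¹ : ∀ β x →
    lookup (permuteVertex⁻¹ β) x ≡ σ (π ⟨$⟩ʳ x) ⟨$⟩ˡ lookup β (π ⟨$⟩ʳ x)
  lookup-permuteVertex⁻¹ β x = lookup∘tabulate _ x

  private
    σ-injective : ∀ y {u v} → σ y ⟨$⟩ʳ u ≡ σ y ⟨$⟩ʳ v → u ≡ v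
    σ-injective y eq = trans (sym (inverseˡ (σ y))) (trans (cong (σ y ⟨$⟩ˡ_) eq) (inverseˡ (σ y)))

    inverse-left : ∀ β → permuteVertex (permuteVertex⁻¹ β) ≡ β
    inverse-left β = lookup-ext λ y → begin
      lookup (permuteVertex (permuteVertex⁻¹ β)) y
        ≡⟨ lookup-permuteVertex (permuteVertex⁻¹ β) y ⟩
      σ y ⟨$⟩ʳ lookup (permuteVertex⁻¹ β) (π ⟨$⟩ˡ y)
        ≡⟨ cong (σ y ⟨$⟩ʳ_) (lookup-permuteVertex⁻¹ β (π ⟨$⟩ˡ y)) ⟩
      σ y ⟨$⟩ʳ (σ (π ⟨$⟩ʳ (π ⟨$⟩ˡ y)) ⟨$⟩ˡ lookup β (π ⟨$⟩ʳ (π ⟨$⟩ˡ y)))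
        ≡⟨ cong (λ z → σ y ⟨$⟩ʳ (σ z ⟨$⟩ˡ lookup β z)) (inverseʳ π) ⟩
      σ y ⟨$⟩ʳ (σ y ⟨$⟩ˡ lookup β y)
        ≡⟨ inverseʳ (σ y) ⟩
      lookup β y ∎
      where open ≡-Reasoning

    inverse-right : ∀ α → permuteVertex⁻¹ (permuteVertex α) ≡ α
    inverse-right α = lookup-ext λ x → begin
      lookup (permuteVertex⁻¹ (permuteVertex α)) x
        ≡⟨ lookup-permuteVertex⁻¹ (permuteVertex α) x ⟩
      σ (π ⟨$⟩ʳ x) ⟨$⟩ˡ lookup (permuteVertex α) (π ⟨$⟩ʳ x)
        ≡⟨ cong (σ (π ⟨$⟩ʳ x) ⟨$⟩ˡ_) (lookup-permuteVertex α (π ⟨$⟩ʳ x)) ⟩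
      σ (π ⟨$⟩ʳ x) ⟨$⟩ˡ (σ (π ⟨$⟩ʳ x) ⟨$⟩ʳ lookup α (π ⟨$⟩ˡ (π ⟨$⟩ʳ x)))
        ≡⟨ inverseˡ (σ (π ⟨$⟩ʳ x)) ⟩
      lookup α (π ⟨$⟩ˡ (π ⟨$⟩ʳ x))
        ≡⟨ cong (lookup α) (inverseˡ π) ⟩
      lookup α x ∎
      where open ≡-Reasoning

    differ⇒ : ∀ α β y → lookup α (π ⟨$⟩ˡ y) ≢ lookup β (π ⟨$⟩ˡ y) →
      lookup (permuteVertex α) y ≢ lookup (permuteVertex β) y
    differ⇒ α β y neq eq = neq (σ-injective y
      (trans (sym (lookup-permuteVertex α y)) (trans eq (lookup-permuteVertex β y))))

    differ⇐ : ∀ α β y → lookup (permuteVertex α) y ≢ lookup (permuteVertex β) y →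
      lookup α (π ⟨$⟩ˡ y) ≢ lookup β (π ⟨$⟩ˡ y)
    differ⇐ α β y neq eq = neq
      (trans (lookup-permuteVertex α y) (trans (cong (σ y ⟨$⟩ʳ_) eq) (sym (lookup-permuteVertex β y))))

    -- Each `σ y` is injective, so `π` carries the positions of difference of two words onto those
    -- of their images.
    adjacent⇒ : ∀ α β → Adjacent α β → Adjacent (permuteVertex α) (permuteVertex β)
    adjacent⇒ α β (i , neq , unique) = π ⟨$⟩ʳ i ,
      differ⇒ α β _ (subst (λ k → lookup α k ≢ lookup β k) (sym (inverseˡ π)) neq) ,
      λ {y} neq′ → trans (cong (π ⟨$⟩ʳ_) (unique (differ⇐ α β y neq′))) (inverseʳ π)

    adjacent⇐ : ∀ α β → Adjacent (permuteVertex α) (permuteVertex β) → Adjacent α β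
    adjacent⇐ α β (y , neq , unique) = π ⟨$⟩ˡ y , differ⇐ α β y neq ,
      λ {k} neq′ → trans (cong (π ⟨$⟩ˡ_) (unique (differ⇒ α β (π ⟨$⟩ʳ k)
        (subst (λ k → lookup α k ≢ lookup β k) (sym (inverseˡ π)) neq′)))) (inverseˡ π)

  permuteVertexᵃ : Automorphism m q
  permuteVertexᵃ = record
    { bijection = mk↔ₛ′ permuteVertex permuteVertex⁻¹ inverse-left inverse-right
    ; adjacency = λ α β → mk⇔ (adjacent⇒ α β) (adjacent⇐ α β)
    }

-- Setwise stabilizers and neighbour sets

module _ {m q : ℕ} (Δ : Pred (Vertex m q) 0ℓ) where

  -- Membership is a pointwise equivalence rather than an equality of images, so closure under
  -- inverses is symmetry of that equivalence.
  setwiseStabilizer : Subgroup (Aut m q) 0ℓ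
  setwiseStabilizer = record
    { Member    = λ g → ∀ α → α ∈ Δ ⇔ to g α ∈ Δ
    ; resp-≈    = λ g≈h g∈ α → subst (λ β → α ∈ Δ ⇔ β ∈ Δ) (g≈h α) (g∈ α)
    ; ε-closed  = λ _ → ⇔-id _
    ; ∙-closed  = λ {_} {h} g∈ h∈ α → g∈ (to h α) ⇔-∘ h∈ α
    ; ⁻¹-closed = λ {g} g∈ α → ⇔-sym
        (subst (λ β → from g α ∈ Δ ⇔ β ∈ Δ) (strictlyInverseˡ g α) (g∈ (from g α)))
    }

  setwiseStabilizer-fixes : FixesSetwise setwiseStabilizer Δ
  setwiseStabilizer-fixes g g∈ =
    (λ { (α , α∈ , refl) → Equivalence.to (g∈ α) α∈ }) ,
    (λ {β} β∈ → from g β ,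
      Equivalence.from (g∈ (from g β)) (subst Δ (sym (strictlyInverseˡ g β)) β∈) ,
      strictlyInverseˡ g β)

Γ₁-preserved : {C : Code m q} (g : Automorphism m q) → (∀ α → α ∈ C ⇔ to g α ∈ C) →
  ∀ ν → ν ∈ Γ₁ C ⇔ to g ν ∈ Γ₁ C
Γ₁-preserved {C = C} g g∈ ν = mk⇔ forth back
  where
  forth : ν ∈ Γ₁ C → to g ν ∈ Γ₁ C
  forth (ν∉ , α , α∈ , ν~α) =
    ν∉ ∘ Equivalence.from (g∈ ν) ,
    to g α , Equivalence.to (g∈ α) α∈ , Equivalence.to (adjacency g ν α) ν~α
  back : to g ν ∈ Γ₁ C → ν ∈ Γ₁ C
  back (gν∉ , β , β∈ , gν~β) =
    gν∉ ∘ Equivalence.to (g∈ ν) ,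
    from g β ,
    Equivalence.from (g∈ (from g β)) (subst C (sym (strictlyInverseˡ g β)) β∈) ,
    Equivalence.from (adjacency g ν (from g β))
      (subst (Adjacent (to g ν)) (sym (strictlyInverseˡ g β)) gν~β)

-- Uniqueness of the differing position only refutes a difference at `k`; decidable equality of
-- letters turns this into agreement.
agree : (α β : Vertex m q) (α~β : Adjacent α β) → ∀ {k} → k ≢ proj₁ α~β → lookup α k ≡ lookup β k
agree α β (i , _ , unique) {k} k≢i =
  decidable-stable (lookup α k ≟ lookup β k) (λ neq → k≢i (sym (unique neq)))

-- Blockwise permutations

module Blocks (p q : ℕ) where

  block : Fin (p * q) → Fin p
  block = quotient q

  offset : Fin (p * q) → Fin q
  offset = remainder {p} q

  combine-block-offset : ∀ i → combine (block i) (offset i) ≡ i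
  combine-block-offset = combine-remQuot {p} q

  block-combine : ∀ b x → block (combine b x) ≡ b
  block-combine b x = cong proj₁ (remQuot-combine b x)

  block-offset-injective : ∀ {i j} → block i ≡ block j → offset i ≡ offset j → i ≡ j
  block-offset-injective {i} {j} b x =
    trans (sym (combine-block-offset i)) (trans (cong₂ combine b x) (combine-block-offset j))

  -- Blocks are consecutive intervals. Hence a position between two positions of one block lies in
  -- that block, as `parity-swap-block` requires.
  block-mono : ∀ {i j} → i <ᶠ j → block i ≤ᶠ block j
  block-mono {i} {j} i<j = ℕ.≮⇒≥ λ bⱼ<bᵢ → ℕ.<-asym i<j
    (subst₂ _<ᶠ_ (combine-block-offset j) (combine-block-offset i)
      (combine-monoˡ-< (offset j) (offset i) bⱼ<bᵢ))

  -- A block has as many positions as there are letters, so these words are the blockwise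
  -- permutations.
  record BlockwiseInjective (α : Vertex (p * q) q) : Set where
    constructor blockwiseInjective
    field
      cancel : ∀ {i j} → block i ≡ block j → lookup α i ≡ lookup α j → i ≡ j

  open BlockwiseInjective public

  blockPermutation : ∀ {α} → BlockwiseInjective α → Fin p → Permutation′ q
  blockPermutation {α} inj b = injective⇒permutation (λ x → lookup α (combine b x)) λ {x} {y} eq →
    combine-injectiveʳ b x b y (cancel inj (trans (block-combine b x) (sym (block-combine b y))) eq)

  position : ∀ {α} → BlockwiseInjective α → ∀ i v → ∃ λ j → block j ≡ block i × lookup α j ≡ v
  position inj i v =
    combine (block i) (π ⟨$⟩ˡ v) , block-combine (block i) (π ⟨$⟩ˡ v) , inverseʳ π
    where π = blockPermutation inj (block i)

  parity-swap-block : ∀ {α i j} → BlockwiseInjective α → i ≢ j → block i ≡ block j →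
    parity (swap i j α) ≡ not (parity α)
  parity-swap-block {α} {i} {j} inj i≢j b = by-order (<-cmp i j)
    where
    ordered : ∀ {i j} → i <ᶠ j → block i ≡ block j → parity (swap i j α) ≡ not (parity α)
    ordered {i} {j} i<j b = parity-swap α i<j (<⇒≢ i<j ∘ cancel inj b) λ k i<k k<j →
      -- Everything between `i` and `j` is in their block, so by injectivity no entry there equals
      -- one of the two swapped letters.
      let bₖ = ≤-antisym (subst (block k ≤ᶠ_) (sym b) (block-mono k<j)) (block-mono i<k)
      in <⇒≢ i<k ∘ sym ∘ cancel inj bₖ , <⇒≢ k<j ∘ cancel inj (trans bₖ b)
    by-order : Tri (i <ᶠ j) (i ≡ j) (j <ᶠ i) → parity (swap i j α) ≡ not (parity α)
    by-order (tri< i<j _ _) = ordered i<j b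
    by-order (tri≈ _ i≡j _) = contradiction i≡j i≢j
    by-order (tri> _ _ j<i) = trans (cong parity (swap-comm i j α)) (ordered j<i (sym b))

  -- A transposition within a block maps every block to itself and can be undone after cancelling in
  -- `α`.
  swap-blockwiseInjective : ∀ {α i j} → block i ≡ block j → BlockwiseInjective α →
    BlockwiseInjective (swap i j α)
  swap-blockwiseInjective {α} {i} {j} b inj = blockwiseInjective λ {k} {l} → swapped-cancel k l
    where
    open ≡-Reasoning
    block-transpose : ∀ k → block (PC.transpose i j k) ≡ block k
    block-transpose k with k ≟ i
    ... | yes refl = sym b
    ... | no _ with k ≟ j
    ...   | yes refl = b
    ...   | no _     = refl
    swapped-cancel : ∀ k l → block k ≡ block l → lookup (swap i j α) k ≡ lookup (swap i j α) l → k ≡ l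
    swapped-cancel k l bₖ≡bₗ eq = begin
      k                                        ≡⟨ PC.transpose-inverse j i ⟨
      PC.transpose j i (PC.transpose i j k)    ≡⟨ cong (PC.transpose j i) transposed ⟩
      PC.transpose j i (PC.transpose i j l)    ≡⟨ PC.transpose-inverse j i ⟩
      l                                        ∎
      where
      transposed : PC.transpose i j k ≡ PC.transpose i j l
      transposed = cancel inj (trans (block-transpose k) (trans bₖ≡bₗ (sym (block-transpose l))))
        (trans (sym (lookup-swap i j α k)) (trans eq (lookup-swap i j α l)))

  -- The letter of `α` at `i` occurs in the same block of `β`, but elsewhere; at that place `α` must
  -- differ from `β`, or it would repeat the letter.
  second-difference : ∀ {α β i} → BlockwiseInjective α → BlockwiseInjective β →
    lookup α i ≢ lookup β i →
    ∃ λ j → block j ≡ block i × lookup β j ≡ lookup α i × j ≢ i × lookup α j ≢ lookup β j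
  second-difference {α} {β} {i} α-inj β-inj αᵢ≢βᵢ with position β-inj i (lookup α i)
  ... | j , b , βⱼ≡αᵢ = j , b , βⱼ≡αᵢ , j≢i , λ eq → j≢i (cancel α-inj b (trans eq βⱼ≡αᵢ))
    where
    j≢i : j ≢ i
    j≢i j≡i = αᵢ≢βᵢ (trans (sym βⱼ≡αᵢ) (cong (lookup β) j≡i))

  blockwiseInjective-nonadjacent : ∀ {α β} → BlockwiseInjective α → BlockwiseInjective β →
    ¬ Adjacent α β
  blockwiseInjective-nonadjacent α-inj β-inj (i , αᵢ≢βᵢ , unique)
    with second-difference α-inj β-inj αᵢ≢βᵢ
  ... | j , _ , _ , j≢i , αⱼ≢βⱼ = j≢i (sym (unique αⱼ≢βⱼ))

  only-two-differences⇒swap : ∀ {α β i j} → BlockwiseInjective α → BlockwiseInjective β →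
    block j ≡ block i → lookup β j ≡ lookup α i → j ≢ i →
    (∀ k → k ≢ i → k ≢ j → lookup α k ≡ lookup β k) → β ≡ swap i j α
  only-two-differences⇒swap {α} {β} {i} {j} α-inj β-inj b βⱼ≡αᵢ j≢i same = lookup-ext pointwise
    where
    βᵢ≡αⱼ : lookup β i ≡ lookup α j
    -- Locate the letter of `α` at `j` in this block of `β`: anywhere other than `i` it would make
    -- `α` repeat a letter.
    βᵢ≡αⱼ with position β-inj i (lookup α j)
    ... | k , bₖ , βₖ≡αⱼ with k ≟ i | k ≟ j
    ... | yes refl | _        = βₖ≡αⱼ
    ... | no _     | yes refl = contradiction (cancel α-inj b (trans (sym βₖ≡αⱼ) βⱼ≡αᵢ)) j≢i
    ... | no k≢i   | no k≢j   =
      contradiction (cancel α-inj (trans bₖ (sym b)) (trans (same k k≢i k≢j) βₖ≡αⱼ)) k≢j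
    pointwise : ∀ k → lookup β k ≡ lookup (swap i j α) k
    pointwise k with k ≟ i | k ≟ j
    ... | yes refl | _        = trans βᵢ≡αⱼ (sym (lookup-swapˡ k j α))
    ... | no _     | yes refl = trans βⱼ≡αᵢ (sym (lookup-swapʳ i k α))
    ... | no k≢i   | no k≢j   = trans (sym (same k k≢i k≢j)) (sym (lookup-swap-other α k≢i k≢j))

  -- One difference forces a second one in its block. Without a third, `β` is a swap of `α` and has
  -- the opposite parity.
  equal-parity⇒3≤d : ∀ {α β} → BlockwiseInjective α → BlockwiseInjective β →
    parity α ≡ parity β → α ≢ β → 3 ≤ d α β
  equal-parity⇒3≤d {α} {β} α-inj β-inj even α≢β
    with ¬∀⟶∃¬ _ _ (λ i → lookup α i ≟ lookup β i) (α≢β ∘ lookup-ext)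
  ... | i , αᵢ≢βᵢ with second-difference α-inj β-inj αᵢ≢βᵢ
  ... | j , b , βⱼ≡αᵢ , j≢i , αⱼ≢βⱼ
    with any? (λ k → ¬? (k ≟ i) ×-dec ¬? (k ≟ j) ×-dec ¬? (lookup α k ≟ lookup β k))
  ... | yes (k , k≢i , k≢j , αₖ≢βₖ) =
    3≤d α β (j≢i ∘ sym) (k≢i ∘ sym) (k≢j ∘ sym) αᵢ≢βᵢ αⱼ≢βⱼ αₖ≢βₖ
  ... | no none = contradiction
    (trans even (trans (cong parity β≡swap) (parity-swap-block α-inj (j≢i ∘ sym) (sym b))))
    (not-¬ refl)
    where
    β≡swap : β ≡ swap i j α
    β≡swap = only-two-differences⇒swap α-inj β-inj b βⱼ≡αᵢ j≢i λ k k≢i k≢j →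
      decidable-stable (lookup α k ≟ lookup β k) (λ neq → none (k , k≢i , k≢j , neq))

  -- The parity codes and their common neighbour set

  ParityCode : Bool → Code (p * q) q
  ParityCode t α = BlockwiseInjective α × parity α ≡ t

  -- A neighbour ν of α repeats a letter of one block in two positions; correcting ν at the
  -- other of these positions yields a word of the opposite parity.
  Γ₁-parityCode : ∀ t ν → ν ∈ Γ₁ BlockwiseInjective ⇔ ν ∈ Γ₁ (ParityCode t)
  Γ₁-parityCode t ν = mk⇔ forth back
    where
    back : ν ∈ Γ₁ (ParityCode t) → ν ∈ Γ₁ BlockwiseInjective
    back (_ , α , (α-inj , _) , ν~α) =
      -- Being outside the code could merely mean having the wrong parity; adjacency to `α` excludes
      -- this.
      (λ ν-inj → blockwiseInjective-nonadjacent ν-inj α-inj ν~α) , α , α-inj , ν~α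
    forth : ν ∈ Γ₁ BlockwiseInjective → ν ∈ Γ₁ (ParityCode t)
    forth (ν∉ , α , α-inj , ν~α@(i , νᵢ≢αᵢ , _)) with parity α ≟ᵇ t
    ... | yes even = ν∉ ∘ proj₁ , α , (α-inj , even) , ν~α
    ... | no odd with position α-inj i (lookup ν i)
    ... | j , b , αⱼ≡νᵢ = ν∉ ∘ proj₁ , swap i j α ,
      (swap-blockwiseInjective (sym b) α-inj ,
       trans (parity-swap-block α-inj (j≢i ∘ sym) (sym b)) (sym (¬-not (odd ∘ sym)))) ,
      j , νⱼ≢ , unique _
      where
      j≢i : j ≢ i
      j≢i refl = νᵢ≢αᵢ (sym αⱼ≡νᵢ)
      νⱼ≢ : lookup ν j ≢ lookup (swap i j α) j
      νⱼ≢ eq = νᵢ≢αᵢ (begin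
        lookup ν i             ≡⟨ αⱼ≡νᵢ ⟨
        lookup α j             ≡⟨ agree ν α ν~α j≢i ⟨
        lookup ν j             ≡⟨ eq ⟩
        lookup (swap i j α) j  ≡⟨ lookup-swapʳ i j α ⟩
        lookup α i             ∎)
        where open ≡-Reasoning
      unique : ∀ k → lookup ν k ≢ lookup (swap i j α) k → j ≡ k
      unique k neq with k ≟ i | k ≟ j
      ... | yes refl | _        = contradiction (trans (sym αⱼ≡νᵢ) (sym (lookup-swapˡ i j α))) neq
      ... | no _     | yes refl = refl
      ... | no k≢i   | no k≢j   =
        contradiction (trans (agree ν α ν~α k≢i) (sym (lookup-swap-other α k≢i k≢j))) neq

  -- Automorphisms carrying one blockwise permutation to another

  -- One `ρ` acts on the offsets of all blocks; this is enough freedom, since transitivity only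
  -- requires steering two positions of a single block.
  coordinates : Permutation′ p → Permutation′ q → Permutation′ (p * q)
  coordinates κ ρ = ↔-sym *↔× ↔-∘ ((κ ×-↔ ρ) ↔-∘ *↔×)

  block-coordinates : ∀ κ ρ i → block (coordinates κ ρ ⟨$⟩ʳ i) ≡ κ ⟨$⟩ʳ block i
  block-coordinates κ ρ i = block-combine (κ ⟨$⟩ʳ block i) (ρ ⟨$⟩ʳ offset i)

  block-coordinates⁻¹ : ∀ κ ρ i → block (coordinates κ ρ ⟨$⟩ˡ i) ≡ κ ⟨$⟩ˡ block i
  block-coordinates⁻¹ κ ρ i = block-combine (κ ⟨$⟩ˡ block i) (ρ ⟨$⟩ˡ offset i)

  module _ {α α′ : Vertex (p * q) q} (α-inj : BlockwiseInjective α) (α′-inj : BlockwiseInjective α′)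
    (κ : Permutation′ p) (ρ : Permutation′ q) where

    private
      π = coordinates κ ρ

    -- A letter is read as its offset in the source block of `α`, moved by `ρ`, and written as the
    -- letter of `α′` at the new offset. This is what makes `transport` send `α` to `α′`.
    symbols : Fin p → Permutation′ q
    symbols b = flip (blockPermutation α-inj (κ ⟨$⟩ˡ b)) ∘ₚ ρ ∘ₚ blockPermutation α′-inj b

    transport : Automorphism (p * q) q
    transport = permuteVertexᵃ (symbols ∘ block) π

    lookup-transport : ∀ β i →
      lookup (to transport β) i ≡ symbols (block i) ⟨$⟩ʳ lookup β (π ⟨$⟩ˡ i)
    lookup-transport = lookup-permuteVertex (symbols ∘ block) π

    transport-maps : to transport α ≡ α′
    transport-maps = lookup-ext λ i → begin
      lookup (to transport α) i
        ≡⟨ lookup-transport α i ⟩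
      blockPermutation α′-inj (block i) ⟨$⟩ʳ (ρ ⟨$⟩ʳ (τ i ⟨$⟩ˡ (τ i ⟨$⟩ʳ (ρ ⟨$⟩ˡ offset i))))
        ≡⟨ cong (λ x → blockPermutation α′-inj (block i) ⟨$⟩ʳ (ρ ⟨$⟩ʳ x)) (inverseˡ (τ i)) ⟩
      blockPermutation α′-inj (block i) ⟨$⟩ʳ (ρ ⟨$⟩ʳ (ρ ⟨$⟩ˡ offset i))
        ≡⟨ cong (blockPermutation α′-inj (block i) ⟨$⟩ʳ_) (inverseʳ ρ) ⟩
      lookup α′ (combine (block i) (offset i))
        ≡⟨ cong (lookup α′) (combine-block-offset i) ⟩
      lookup α′ i ∎
      where
      open ≡-Reasoning
      τ : Fin (p * q) → Permutation′ q
      τ i = blockPermutation α-inj (κ ⟨$⟩ˡ block i)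

    -- Positions move block by block, and all letters of a target block undergo the same
    -- permutation.
    transport-blockwiseInjective : ∀ β → BlockwiseInjective β ⇔ BlockwiseInjective (to transport β)
    transport-blockwiseInjective β = mk⇔ forth back
      where
      open ≡-Reasoning
      πˡ = π ⟨$⟩ˡ_
      πʳ = π ⟨$⟩ʳ_
      forth : BlockwiseInjective β → BlockwiseInjective (to transport β)
      forth β-inj = blockwiseInjective λ {i} {j} → cancelled i j
        where
        cancelled : ∀ i j → block i ≡ block j →
          lookup (to transport β) i ≡ lookup (to transport β) j → i ≡ j
        cancelled i j b eq = begin
          i           ≡⟨ inverseʳ π ⟨
          πʳ (πˡ i)   ≡⟨ cong πʳ (cancel β-inj same-block same-entry) ⟩
          πʳ (πˡ j)   ≡⟨ inverseʳ π ⟩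
          j           ∎
          where
          same-block : block (πˡ i) ≡ block (πˡ j)
          same-block = trans (block-coordinates⁻¹ κ ρ i)
            (trans (cong (κ ⟨$⟩ˡ_) b) (sym (block-coordinates⁻¹ κ ρ j)))
          σ = symbols (block i)
          same-entry : lookup β (πˡ i) ≡ lookup β (πˡ j)
          same-entry = begin
            lookup β (πˡ i)                       ≡⟨ inverseˡ σ ⟨
            σ ⟨$⟩ˡ (σ ⟨$⟩ʳ lookup β (πˡ i))       ≡⟨ cong (σ ⟨$⟩ˡ_) (lookup-transport β i) ⟨
            σ ⟨$⟩ˡ lookup (to transport β) i      ≡⟨ cong (σ ⟨$⟩ˡ_) eq ⟩
            σ ⟨$⟩ˡ lookup (to transport β) j      ≡⟨ cong (σ ⟨$⟩ˡ_) (lookup-transport β j) ⟩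
            σ ⟨$⟩ˡ (symbols (block j) ⟨$⟩ʳ lookup β (πˡ j))
              ≡⟨ cong (λ c → σ ⟨$⟩ˡ (symbols c ⟨$⟩ʳ lookup β (πˡ j))) b ⟨
            σ ⟨$⟩ˡ (σ ⟨$⟩ʳ lookup β (πˡ j))       ≡⟨ inverseˡ σ ⟩
            lookup β (πˡ j)                       ∎
      back : BlockwiseInjective (to transport β) → BlockwiseInjective β
      back gβ-inj = blockwiseInjective λ {i} {j} → cancelled i j
        where
        cancelled : ∀ i j → block i ≡ block j → lookup β i ≡ lookup β j → i ≡ j
        cancelled i j b eq = begin
          i           ≡⟨ inverseˡ π ⟨
          πˡ (πʳ i)   ≡⟨ cong πˡ (cancel gβ-inj same-block same-entry) ⟩
          πˡ (πʳ j)   ≡⟨ inverseˡ π ⟩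
          j           ∎
          where
          same-block : block (πʳ i) ≡ block (πʳ j)
          same-block = trans (block-coordinates κ ρ i)
            (trans (cong (κ ⟨$⟩ʳ_) b) (sym (block-coordinates κ ρ j)))
          σ = symbols (block (πʳ j))
          same-entry : lookup (to transport β) (πʳ i) ≡ lookup (to transport β) (πʳ j)
          same-entry = begin
            lookup (to transport β) (πʳ i)
              ≡⟨ lookup-transport β (πʳ i) ⟩
            symbols (block (πʳ i)) ⟨$⟩ʳ lookup β (πˡ (πʳ i))
              ≡⟨ cong₂ (λ c k → symbols c ⟨$⟩ʳ lookup β k) same-block (inverseˡ π) ⟩
            σ ⟨$⟩ʳ lookup β i
              ≡⟨ cong (σ ⟨$⟩ʳ_) eq ⟩
            σ ⟨$⟩ʳ lookup β j
              ≡⟨ cong (λ k → σ ⟨$⟩ʳ lookup β k) (inverseˡ π) ⟨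
            σ ⟨$⟩ʳ lookup β (πˡ (πʳ j))
              ≡⟨ lookup-transport β (πʳ j) ⟨
            lookup (to transport β) (πʳ j) ∎

    -- Both neighbours repeat a letter of the word they are adjacent to, so it suffices that
    -- the positions of the change and of the repetition correspond.
    transport-neighbour : ∀ ν ν′ {i j i′ j′} →
      block i′ ≡ block j′ → π ⟨$⟩ʳ i ≡ i′ → π ⟨$⟩ʳ j ≡ j′ →
      (∀ {k} → k ≢ i → lookup ν k ≡ lookup α k) → lookup α j ≡ lookup ν i →
      (∀ {k} → k ≢ i′ → lookup ν′ k ≡ lookup α′ k) → lookup α′ j′ ≡ lookup ν′ i′ →
      to transport ν ≡ ν′
    transport-neighbour ν ν′ {i} {j} {i′} {j′} b πi≡i′ πj≡j′ agrees αⱼ≡νᵢ agrees′ α′ⱼ≡ν′ᵢ =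
      lookup-ext pointwise
      where
      open ≡-Reasoning
      πˡ = π ⟨$⟩ˡ_
      πˡi′≡i : πˡ i′ ≡ i
      πˡi′≡i = trans (cong πˡ (sym πi≡i′)) (inverseˡ π)
      πˡj′≡j : πˡ j′ ≡ j
      πˡj′≡j = trans (cong πˡ (sym πj≡j′)) (inverseˡ π)
      pointwise : ∀ k → lookup (to transport ν) k ≡ lookup ν′ k
      pointwise k with k ≟ i′
      -- The entry of `ν` at `i` is treated like the equal entry of `α` at `j`, because `i′` and
      -- `j′` lie in one block.
      ... | yes refl = begin
        lookup (to transport ν) i′                        ≡⟨ lookup-transport ν i′ ⟩
        symbols (block i′) ⟨$⟩ʳ lookup ν (πˡ i′)          ≡⟨ cong₂ (λ c l → symbols c ⟨$⟩ʳ lookup ν l) b πˡi′≡i ⟩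
        symbols (block j′) ⟨$⟩ʳ lookup ν i                ≡⟨ cong (symbols (block j′) ⟨$⟩ʳ_) αⱼ≡νᵢ ⟨
        symbols (block j′) ⟨$⟩ʳ lookup α j                ≡⟨ cong (λ l → symbols (block j′) ⟨$⟩ʳ lookup α l) πˡj′≡j ⟨
        symbols (block j′) ⟨$⟩ʳ lookup α (πˡ j′)          ≡⟨ lookup-transport α j′ ⟨
        lookup (to transport α) j′                        ≡⟨ cong (λ β → lookup β j′) transport-maps ⟩
        lookup α′ j′                                      ≡⟨ α′ⱼ≡ν′ᵢ ⟩
        lookup ν′ i′                                      ∎
      ... | no k≢i′ = begin
        lookup (to transport ν) k                         ≡⟨ lookup-transport ν k ⟩
        symbols (block k) ⟨$⟩ʳ lookup ν (πˡ k)            ≡⟨ cong (symbols (block k) ⟨$⟩ʳ_) (agrees πˡk≢i) ⟩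
        symbols (block k) ⟨$⟩ʳ lookup α (πˡ k)            ≡⟨ lookup-transport α k ⟨
        lookup (to transport α) k                         ≡⟨ cong (λ β → lookup β k) transport-maps ⟩
        lookup α′ k                                       ≡⟨ agrees′ k≢i′ ⟨
        lookup ν′ k                                       ∎
        where
        πˡk≢i : πˡ k ≢ i
        πˡk≢i eq = k≢i′ (trans (sym (inverseʳ π))
          (trans (cong (π ⟨$⟩ʳ_) eq) πi≡i′))

  -- The group and its action on the neighbour set

  module _ (t : Bool) where

    -- With the full stabilizer, invariance of the neighbour set is immediate; transitivity and
    -- moving the code only need suitable elements.
    X : Subgroup (Aut (p * q) q) 0ℓ
    X = setwiseStabilizer (Γ₁ (ParityCode t))

    -- Parity need not be respected, since the neighbours of the parity code are those of all
    -- blockwise permutations.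
    blockwiseInjective-preserving⇒X : ∀ g →
      (∀ α → BlockwiseInjective α ⇔ BlockwiseInjective (to g α)) → g ∈ Subgroup.Member X
    blockwiseInjective-preserving⇒X g preserves ν =
      Γ₁-parityCode t (to g ν) ⇔-∘ (Γ₁-preserved g preserves ν ⇔-∘ ⇔-sym (Γ₁-parityCode t ν))

    transport∈X : ∀ {α α′} (α-inj : BlockwiseInjective α) (α′-inj : BlockwiseInjective α′) κ ρ →
      transport α-inj α′-inj κ ρ ∈ Subgroup.Member X
    transport∈X α-inj α′-inj κ ρ = blockwiseInjective-preserving⇒X (transport α-inj α′-inj κ ρ)
      (transport-blockwiseInjective α-inj α′-inj κ ρ)

    -- A neighbour is determined by a blockwise permutation, the changed position `i` and the
    -- position `j` of the letter repeated there. `κ` matches the blocks and `ρ` the offsets of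
    -- these positions, which are distinct.
    X-transitive : TransitiveOn X (Γ₁ (ParityCode t))
    X-transitive {ν} {ν′} (_ , α , (α-inj , _) , ν~α@(i , νᵢ≢αᵢ , _))
                          (_ , α′ , (α′-inj , _) , ν′~α′@(i′ , ν′ᵢ≢α′ᵢ , _))
      with position α-inj i (lookup ν i) | position α′-inj i′ (lookup ν′ i′)
    ... | j , b , αⱼ≡νᵢ | j′ , b′ , α′ⱼ≡ν′ᵢ
      with permutation-through-pairs {x = offset i} {offset j} {offset i′} {offset j′}
             (λ eq → νᵢ≢αᵢ (trans (sym αⱼ≡νᵢ) (cong (lookup α) (sym (block-offset-injective (sym b) eq)))))
             (λ eq → ν′ᵢ≢α′ᵢ (trans (sym α′ⱼ≡ν′ᵢ) (cong (lookup α′) (sym (block-offset-injective (sym b′) eq)))))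
    ... | ρ , ρx≡x′ , ρy≡y′ =
      transport α-inj α′-inj κ ρ , transport∈X α-inj α′-inj κ ρ ,
      transport-neighbour α-inj α′-inj κ ρ ν ν′ (sym b′)
        (coordinates-maps i i′ refl refl ρx≡x′) (coordinates-maps j j′ b b′ ρy≡y′)
        (agree ν α ν~α) αⱼ≡νᵢ (agree ν′ α′ ν′~α′) α′ⱼ≡ν′ᵢ
      where
      κ = transpose (block i) (block i′)
      coordinates-maps : ∀ k k′ → block k ≡ block i → block k′ ≡ block i′ →
        ρ ⟨$⟩ʳ offset k ≡ offset k′ → coordinates κ ρ ⟨$⟩ʳ k ≡ k′
      coordinates-maps k k′ bₖ bₖ′ ρk≡k′ = trans
        (cong₂ combine
          (trans (cong (κ ⟨$⟩ʳ_) bₖ) (trans (transpose-ˡ (block i) (block i′)) (sym bₖ′)))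
          ρk≡k′)
        (combine-block-offset k′)

    -- The witness is the `transport` from `α` to a swap of `α` in one block: it lies in `X` but
    -- changes the parity of `α`.
    X-moves : ∀ {α i j} → α ∈ ParityCode t → i ≢ j → block i ≡ block j →
      ¬ FixesSetwise X (ParityCode t)
    X-moves {α} {i} {j} α∈@(α-inj , even) i≢j b fixes =
      not-¬ refl (trans even (trans (sym (proj₂ swapped∈)) (parity-swap-block α-inj i≢j b)))
      where
      swapped-inj : BlockwiseInjective (swap i j α)
      swapped-inj = swap-blockwiseInjective b α-inj
      g = transport α-inj swapped-inj idₚ idₚ
      swapped∈ : swap i j α ∈ ParityCode t
      swapped∈ = proj₁ (fixes g (transport∈X α-inj swapped-inj idₚ idₚ))
        (α , α∈ , transport-maps α-inj swapped-inj idₚ idₚ)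

  -- Minimum distance 3 and the elusive pair

  offsets : Vertex (p * q) q
  offsets = tabulate offset

  offsets-blockwiseInjective : BlockwiseInjective offsets
  offsets-blockwiseInjective = blockwiseInjective λ {i} {j} b eq → block-offset-injective b
    (trans (sym (lookup∘tabulate offset i)) (trans eq (lookup∘tabulate offset j)))

d-refl : (α : Vertex m q) → d α α ≡ 0
d-refl []      = refl
d-refl (x ∷ α) rewrite dec-true (x ≟ x) refl = d-refl α

d-rotate : {x y z : Fin q} (α : Vertex m q) → x ≢ y → y ≢ z → z ≢ x →
  d (x ∷ y ∷ z ∷ α) (y ∷ z ∷ x ∷ α) ≡ 3
d-rotate {x = x} {y} {z} α x≢y y≢z z≢x
  rewrite dec-false (x ≟ y) x≢y | dec-false (y ≟ z) y≢z | dec-false (z ≟ x) z≢x | d-refl α = refl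

module _ (p q : ℕ) where

  open Blocks (suc p) (suc (suc (suc q)))

  private
    i₀ i₁ i₂ : Fin (suc p * suc (suc (suc q)))
    i₀ = zero
    i₁ = suc zero
    i₂ = suc (suc zero)

  parityCode-attains-3 : ∀ α → BlockwiseInjective α →
    ∃₂ λ β γ → β ∈ ParityCode (parity α) × γ ∈ ParityCode (parity α) × β ≢ γ × d β γ ≡ 3
  parityCode-attains-3 α@(x ∷ y ∷ z ∷ ξ) inj =
    -- Two swaps inside the first block rotate its first three entries; the parity flips twice and
    -- so is restored.
    α , swap i₁ i₂ (swap i₀ i₁ α) , (inj , refl) ,
    (swap-blockwiseInjective {i = i₁} {i₂} refl inj₁ ,
     trans (parity-swap-block {i = i₁} {i₂} inj₁ (λ ()) refl)
       (trans (cong not (parity-swap-block {i = i₀} {i₁} inj (λ ()) refl))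
         (not-involutive (parity α)))) ,
    x≢y ∘ cong head , d-rotate ξ x≢y y≢z z≢x
    where
    inj₁ = swap-blockwiseInjective {α} {i₀} {i₁} refl inj
    x≢y : x ≢ y
    x≢y eq = contradiction (cancel inj {i₀} {i₁} refl eq) λ ()
    y≢z : y ≢ z
    y≢z eq = contradiction (cancel inj {i₁} {i₂} refl eq) λ ()
    z≢x : z ≢ x
    z≢x eq = contradiction (cancel inj {i₂} {i₀} refl eq) λ ()

  -- Taking the parity of `offsets` for `t` provides a codeword without computing an inversion
  -- number.
  parityCode-elusive : let t = parity offsets in ElusivePair _ _ 3 (ParityCode t) (X t)
  parityCode-elusive = record
    { minimumDistance = record
      { attained   = parityCode-attains-3 offsets offsets-blockwiseInjective
      ; lowerBound = λ (α-inj , even) (β-inj , even′) →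
          equal-parity⇒3≤d α-inj β-inj (trans even (sym even′))
      }
    ; fixesNeighbours = setwiseStabilizer-fixes (Γ₁ (ParityCode (parity offsets)))
    ; movesCode = X-moves (parity offsets) {i = i₀} {i₁}
        (offsets-blockwiseInjective , refl) (λ ()) refl
    }

theorem1p2 : (m q : ℕ) → 3 ≤ q → 0 < m → q ∣ m →
    Σ (Code m q) λ C → Σ (Subgroup (Aut m q) 0ℓ) λ X →
    ElusivePair m q 3 C X × TransitiveOn X (Γ₁ C)
-- The quotient of `m` by `q` is the number of blocks, and `0 < m` makes it a successor.
theorem1p2 _ (suc (suc (suc q))) (s≤s (s≤s (s≤s _))) _ (divides (suc p) refl) =
  ParityCode t , X t , parityCode-elusive p q , X-transitive t
  where
  open Blocks (suc p) (suc (suc (suc q)))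
  t = parity offsets
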